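{- Let $E^{\mathrm{ce}}$ be an equivalence relation on $\omega$ extending $=^{\mathrm{ce}}$ and let $\mathfrak{K}$ be a family of nonempty c.e. sets. If a learner $\mathbf{M}$ $E^{\mathrm{ce}}$-learns $\mathfrak{K}$, then for every $e\in\omega$ with $W_e\in\mathfrak{K}$ there is an $E^{\mathrm{ce}}$-locking sequence for $\mathbf{M}$ on $W_e$.
   Context: Fix a standard (acceptable) enumeration $(\varphi_e)_{e\in\omega}$ of the partial computable functions and let $W_e=\operatorname{dom}(\varphi_e)$. Write $e=^{\mathrm{ce}}e'$ iff $W_e=W_{e'}$. Equivalence relations on $\omega$ extending $=^{\mathrm{ce}}$ are arbitrary (no definability or effectivity is assumed). An enumeration of a set $A$ is a surjection $\mu:\omega\to A$; $\mu[s]$ denotes the finite string $\mu(0),\dots,\mu(s-1)$. A learner is an arbitrary function $\mathbf{M}:\omega^{<\omega}\to\omega$ (no effectivity is assumed). The learner $\mathbf{M}$ $E^{\mathrm{ce}}$-learns a family $\mathfrak{K}$ of nonempty c.e. sets if for every $e$ with $W_e\in\mathfrak{K}$ and every enumeration $\mu$ of $W_e$ there is $i\in\omega$ with $i\mathrel{E^{\mathrm{ce}}}e$ and $\mathbf{M}(\mu[s])=i$ for all sufficiently large $s$. For $\sigma\in\omega^{<\omega}$, $\operatorname{range}(\sigma)=\{\sigma(n):n<|\sigma|\}$, and $\sigma\tau$ denotes the concatenation of $\sigma$ followed by $\tau$. A finite string $\sigma\in\omega^{<\omega}$ is an $E^{\mathrm{ce}}$-locking sequence for $\mathbf{M}$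 on $W_e$ if: (a) $\operatorname{range}(\sigma)\subseteq W_e$; (b) $\mathbf{M}(\sigma)\mathrel{E^{\mathrm{ce}}}e$; (c) for every $\tau\in\omega^{<\omega}$, if $\operatorname{range}(\tau)\subseteq W_e$ then $\mathbf{M}(\sigma\tau)=\mathbf{M}(\sigma)$. -}

module Defs where

open import Data.Fin.Base using (Fin; zero; suc)
open import Data.List.Base using (List; _++_; applyUpTo)
import Data.List.Membership.Propositional as List
open import Data.Nat.Base using (ℕ; zero; suc; _≤_; _<_)
open import Data.Nat.Properties using (<-cmp)
open import Data.Product.Base using (∃; _×_; _,_; proj₂)
open import Data.Vec.Base using (Vec; []; _∷_; lookup)
open import Function.Bundles using (_⇔_; mk⇔; Equivalence)
open import Level using (Level; 0ℓ; _⊔_)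
open import Relation.Binary.Core using (Rel)
open import Relation.Binary.Definitions using (_Respects_; tri<; tri≈; tri>)
open import Relation.Binary.PropositionalEquality
  using (_≡_; refl)
open import Relation.Unary using (Pred; _∈_; _⊆_; _≐_; Satisfiable)

private
  variable
    ℓ k : Level
    m n : ℕ

------------------------------------------------------------------------
-- Partial computable functions, as Kleene's μ-recursive functions

data Rec : ℕ → Set where
  zer  : Rec n
  succ : Rec 1
  proj : Fin n → Rec n
  comp : Rec m → Vec (Rec n) m → Rec n
  prec : Rec n → Rec (suc (suc n)) → Rec (suc n)
  mu   : Rec (suc n) → Rec n

-- f [ xs ]↓ y : the computation of f on xs halts with output y.
-- fs [ xs ]↓* ys : each component of fs halts on xs, with outputs ys.

infix 4 _[_]↓_ _[_]↓*_

data _[_]↓_ : Rec n → Vec ℕ n → ℕ → Set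
data _[_]↓*_ {n : ℕ} : Vec (Rec n) m → Vec ℕ n → Vec ℕ m → Set

data _[_]↓_ where
  ↓zer   : {xs : Vec ℕ n} → zer [ xs ]↓ 0
  ↓succ  : ∀ {x} → succ [ x ∷ [] ]↓ suc x
  ↓proj  : {i : Fin n} {xs : Vec ℕ n} → proj i [ xs ]↓ lookup xs i
  ↓comp  : {f : Rec m} {gs : Vec (Rec n) m} {xs : Vec ℕ n} {ys : Vec ℕ m} {z : ℕ} →
           gs [ xs ]↓* ys → f [ ys ]↓ z → comp f gs [ xs ]↓ z
  ↓prec0 : {f : Rec n} {g : Rec (suc (suc n))} {xs : Vec ℕ n} {y : ℕ} →
           f [ xs ]↓ y → prec f g [ 0 ∷ xs ]↓ y
  ↓precS : {f : Rec n} {g : Rec (suc (suc n))} {xs : Vec ℕ n} {t y z : ℕ} →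
           prec f g [ t ∷ xs ]↓ y → g [ t ∷ y ∷ xs ]↓ z →
           prec f g [ suc t ∷ xs ]↓ z
  ↓mu    : {f : Rec (suc n)} {xs : Vec ℕ n} {y : ℕ} →
           f [ y ∷ xs ]↓ 0 →
           (∀ t → t < y → ∃ λ v → f [ t ∷ xs ]↓ suc v) →
           mu f [ xs ]↓ y

data _[_]↓*_ {n} where
  []  : ∀ {xs} → [] [ xs ]↓* []
  _∷_ : ∀ {g : Rec n} {gs : Vec (Rec n) m} {xs y ys} →
        g [ xs ]↓ y → gs [ xs ]↓* ys → (g ∷ gs) [ xs ]↓* (y ∷ ys)

↓-functional  : {f : Rec n} {xs : Vec ℕ n} {y z : ℕ} →
                f [ xs ]↓ y → f [ xs ]↓ z → y ≡ z
↓*-functional : {fs : Vec (Rec n) m} {xs : Vec ℕ n} {ys zs : Vec ℕ m} →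
                fs [ xs ]↓* ys → fs [ xs ]↓* zs → ys ≡ zs

↓-functional ↓zer ↓zer = refl
↓-functional ↓succ ↓succ = refl
↓-functional ↓proj ↓proj = refl
↓-functional (↓comp ps p) (↓comp qs q) with refl ← ↓*-functional ps qs =
  ↓-functional p q
↓-functional (↓prec0 p) (↓prec0 q) = ↓-functional p q
↓-functional (↓precS p p′) (↓precS q q′) with refl ← ↓-functional p q =
  ↓-functional p′ q′
↓-functional (↓mu {y = y} p below-y) (↓mu {y = z} q below-z) with <-cmp y z
... | tri≈ _ y≡z _ = y≡z
... | tri< y<z _ _ with () ← ↓-functional p (proj₂ (below-z y y<z))
... | tri> _ _ z<y with () ← ↓-functional (proj₂ (below-y z z<y)) q

↓*-functional [] [] = refl
↓*-functional (p ∷ ps) (q ∷ qs)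
  with refl ← ↓-functional p q | refl ← ↓*-functional ps qs = refl

-- An acceptable enumeration of the unary partial computable functions: one
-- satisfying the enumeration theorem and the s-m-n theorem.  A partial
-- function is given by its graph, so φ e x y says that φₑ(x) is defined with
-- value y.  That every partial computable function occurs is a consequence
-- of s-m-n; see φ-onto.

record AcceptableEnumeration : Set₁ where
  field
    φ         : ℕ → ℕ → ℕ → Set
    universal : ∃ λ (u : Rec 2) → ∀ e x y → φ e x y ⇔ u [ e ∷ x ∷ [] ]↓ y
    smn       : (g : Rec 2) → ∃ λ (s : Rec 1) →
                ∀ e → ∃ λ i → s [ e ∷ [] ]↓ i ×
                  (∀ x y → φ i x y ⇔ g [ e ∷ x ∷ [] ]↓ y)

  φ-functional : ∀ {e x y z} → φ e x y → φ e x z → y ≡ z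
  φ-functional p q =
    ↓-functional (Equivalence.to (proj₂ universal _ _ _) p)
                 (Equivalence.to (proj₂ universal _ _ _) q)

  φ-onto : (f : Rec 1) → ∃ λ i → ∀ x y → φ i x y ⇔ f [ x ∷ [] ]↓ y
  φ-onto f with smn (comp f (proj (suc zero) ∷ []))
  ... | _ , h with h 0
  ... | i , _ , eqv = i , λ x y → mk⇔
    (λ p → drop (Equivalence.to (eqv x y) p))
    (λ p → Equivalence.from (eqv x y) (↓comp (↓proj ∷ []) p))
    where
    drop : ∀ {x y} → comp f (proj (suc zero) ∷ []) [ 0 ∷ x ∷ [] ]↓ y →
           f [ x ∷ [] ]↓ y
    drop (↓comp (↓proj ∷ []) p) = p

  W : ℕ → Pred ℕ 0ℓ
  W e x = ∃ λ y → φ e x y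

  infix 4 _=ᶜᵉ_
  _=ᶜᵉ_ : Rel ℕ 0ℓ
  e =ᶜᵉ e′ = W e ≐ W e′

  IsCE : Pred (Pred ℕ 0ℓ) 0ℓ
  IsCE A = ∃ λ e → A ≐ W e

  -- Predicates with the same elements are the same set, so a family of sets
  -- has to respect _≐_.
  record IsNonemptyCEFamily (𝔎 : Pred (Pred ℕ 0ℓ) k) : Set (Level.suc 0ℓ ⊔ k) where
    field
      respects : 𝔎 Respects _≐_
      nonempty : ∀ {A} → A ∈ 𝔎 → Satisfiable A
      ce       : ∀ {A} → A ∈ 𝔎 → IsCE A

------------------------------------------------------------------------
-- Learning

Learner : Set
Learner = List ℕ → ℕ

record Enumerates (μ : ℕ → ℕ) (A : Pred ℕ 0ℓ) : Set where
  field
    into : ∀ n → μ n ∈ A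
    onto : ∀ {x} → x ∈ A → ∃ λ n → μ n ≡ x

infix 8 _[_]
_[_] : (ℕ → ℕ) → ℕ → List ℕ
μ [ s ] = applyUpTo μ s

range : List ℕ → Pred ℕ 0ℓ
range σ x = x List.∈ σ

module _ (Φ : AcceptableEnumeration) (E : Rel ℕ ℓ) (M : Learner) where
  open AcceptableEnumeration Φ

  Learns : Pred (Pred ℕ 0ℓ) k → Set (ℓ ⊔ k)
  Learns 𝔎 =
    ∀ e → W e ∈ 𝔎 → ∀ μ → Enumerates μ (W e) →
    ∃ λ i → E i e × ∃ λ N → ∀ s → N ≤ s → M (μ [ s ]) ≡ i

  record IsLockingSequence (e : ℕ) (σ : List ℕ) : Set ℓ where
    field
      range⊆ : range σ ⊆ W e
      correct : E (M σ) e
      locked : ∀ τ → range τ ⊆ W e → M (σ ++ τ) ≡ M σ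

{-# OPTIONS --safe #-}

-- Fix an enumeration ν of W e and build strings σ₀ ≼ σ₁ ≼ ⋯ over W e as
-- follows: put ρₙ = σₙ ν(n), and let σₙ₊₁ = ρₙ τₙ, where τₙ is a string over
-- W e that makes M change its mind after ρₙ, if there is one.  The limit of the
-- σₙ enumerates W e, so M stabilises along it at a correct conjecture, from
-- length N on.  Both ρ_N and σ_{N+1} = ρ_N τ_N are initial segments of the
-- limit of length at least N, so τ_N causes no mind change.  Hence no string
-- over W e does, and ρ_N is locking.

module Submission where

open import Defs
open import Axiom.ExcludedMiddle using (ExcludedMiddle)
open import Data.Nat.Base using (ℕ)
open import Data.Product.Base using (∃)
open import Level using (0ℓ)
open import Relation.Binary.Core using (Rel; _⇒_)
open import Relation.Binary.Structures using (IsEquivalence)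
open import Relation.Unary using (Pred; _∈_)
open AcceptableEnumeration using (W; _=ᶜᵉ_; IsNonemptyCEFamily)

open import Data.List.Base using (List; []; _∷_; _++_; _∷ʳ_; length; applyUpTo)
import Data.List.Membership.Propositional as Mem
open import Data.List.Membership.Propositional.Properties
  using (∈-++⁺ʳ; ∈-++⁻; ∈-applyUpTo⁻)
open import Data.List.Properties
  using (++-assoc; ++-identityʳ; length-++; length-++-≤ˡ)
open import Data.List.Relation.Unary.Any using (here; there)
open import Data.Nat.Base
  using (zero; suc; _+_; _≤_; _<_; _≤′_; ≤′-refl; ≤′-step; s<s⁻¹; z<s; s<s; z≤n; _⊔_)
open import Data.Nat.Properties
  using (_≟_; ≤⇒≤′; m≤m⊔n; m≤n⊔m; +-comm; +-monoˡ-≤; n≤1+n; ≤-trans; module ≤-Reasoning)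
open import Data.Product.Base using (_×_; _,_; proj₁; proj₂)
open import Data.Sum.Base using ([_,_]′)
open import Function.Base using (_∘_)
open import Level using (Lift; lift; lower)
open import Relation.Binary.PropositionalEquality
  using (_≡_; _≢_; refl; sym; trans; cong; cong₂; subst)
open import Relation.Nullary.Decidable using (yes; no; map′; decidable-stable)
open import Relation.Nullary.Negation using (contradiction)
open import Relation.Unary using (_⊆_; Satisfiable)

lowerEM : ∀ {ℓ} → ExcludedMiddle ℓ → ExcludedMiddle 0ℓ
lowerEM {ℓ} em {P} = map′ lower lift (em {Lift ℓ P})

-- Members of `A` are fixed and every other number is sent to `a`; excluded middle decides which
-- case applies.
enumeration : ExcludedMiddle 0ℓ → {A : Pred ℕ 0ℓ} → Satisfiable A →
              ∃ λ ν → Enumerates ν A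
enumeration em {A} (a , a∈A) = ν , record { into = into ; onto = onto }
  where
  ν : ℕ → ℕ
  ν n with em {A n}
  ... | yes _ = n
  ... | no  _ = a

  into : ∀ n → ν n ∈ A
  into n with em {A n}
  ... | yes n∈A = n∈A
  ... | no  _   = a∈A

  onto : ∀ {x} → x ∈ A → ∃ λ n → ν n ≡ x
  onto {x} x∈A = x , ν-fixes
    where
    ν-fixes : ν x ≡ x
    ν-fixes with em {A x}
    ... | yes _   = refl
    ... | no  x∉A = contradiction x∈A x∉A

module _ {a} {A : Set a} where

  infix 4 _≼_
  _≼_ : Rel (List A) a
  xs ≼ ys = ∃ λ zs → ys ≡ xs ++ zs

  ≼-refl : ∀ {xs} → xs ≼ xs
  ≼-refl = [] , sym (++-identityʳ _)

  ≼-trans : ∀ {xs ys zs} → xs ≼ ys → ys ≼ zs → xs ≼ zs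
  ≼-trans {xs} (us , refl) (vs , refl) = us ++ vs , ++-assoc xs us vs

  -- The default `d` makes indexing total, so that `limit` can be written without length proofs.
  at : A → List A → ℕ → A
  at d []       _       = d
  at d (x ∷ _)  zero    = x
  at d (_ ∷ xs) (suc n) = at d xs n

  at-∈ : ∀ {p} {P : Pred A p} {d} → d ∈ P →
         ∀ xs → (∀ {x} → x Mem.∈ xs → x ∈ P) → ∀ n → at d xs n ∈ P
  at-∈ d∈P []       xs⊆P n       = d∈P
  at-∈ d∈P (x ∷ xs) xs⊆P zero    = xs⊆P (here refl)
  at-∈ d∈P (x ∷ xs) xs⊆P (suc n) = at-∈ d∈P xs (xs⊆P ∘ there) n

  at-≼ : ∀ {d xs ys n} → xs ≼ ys → n < length xs → at d ys n ≡ at d xs n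
  at-≼ {xs = _ ∷ _}  {n = zero}  (_ , refl)  _   = refl
  at-≼ {xs = _ ∷ xs} {n = suc n} (zs , refl) n<l = at-≼ {xs = xs} (zs , refl) (s<s⁻¹ n<l)

  applyUpTo-at : ∀ {d} f xs → (∀ n → n < length xs → f n ≡ at d xs n) →
                 applyUpTo f (length xs) ≡ xs
  applyUpTo-at f []       f≗xs = refl
  applyUpTo-at f (x ∷ xs) f≗xs =
    cong₂ _∷_ (f≗xs 0 z<s) (applyUpTo-at (f ∘ suc) xs λ n n<l → f≗xs (suc n) (s<s n<l))

  module Limit (d : A) (σ : ℕ → List A)
               (σ-step : ∀ n → σ n ≼ σ (suc n)) (σ-long : ∀ n → n ≤ length (σ n)) where

    -- Stage `suc n` is long enough to have a position `n`, so the default is never read.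
    limit : ℕ → A
    limit n = at d (σ (suc n)) n

    σ-mono : ∀ {m n} → m ≤ n → σ m ≼ σ n
    σ-mono = go ∘ ≤⇒≤′
      where
      go : ∀ {m n} → m ≤′ n → σ m ≼ σ n
      go ≤′-refl       = ≼-refl
      go (≤′-step m≤n) = ≼-trans (go m≤n) (σ-step _)

    limit-initial : ∀ {xs} m → xs ≼ σ m → applyUpTo limit (length xs) ≡ xs
    limit-initial {xs} m xs≼σm = applyUpTo-at {d} limit xs λ n n<l →
      -- Both `σ m` and `σ (suc n)` are prefixes of the stage `m ⊔ suc n`, where the two readings of
      -- entry `n` are compared.
      trans (sym (at-≼ (σ-mono (m≤n⊔m m (suc n))) (σ-long (suc n))))
            (at-≼ (≼-trans xs≼σm (σ-mono (m≤m⊔n m (suc n)))) n<l)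

module _ (em : ExcludedMiddle 0ℓ) {A : Pred ℕ 0ℓ} (M : Learner) where

  Locked : Pred (List ℕ) 0ℓ
  Locked ρ = ∀ τ → range τ ⊆ A → M (ρ ++ τ) ≡ M ρ

  -- If some string over `A` changes the conjecture, it is taken as `τ` and the implication is
  -- vacuous; otherwise `[]` serves and `ρ` is already locked. The implication covers both cases, so
  -- the construction of `σ` need not branch.
  mindChange : ∀ ρ → ∃ λ τ → range τ ⊆ A × (M (ρ ++ τ) ≡ M ρ → Locked ρ)
  mindChange ρ with em {∃ λ τ → range τ ⊆ A × M (ρ ++ τ) ≢ M ρ}
  ... | yes (τ , τ⊆A , change) = τ , τ⊆A , λ same → contradiction same change
  ... | no  none = [] , (λ ()) , λ _ τ τ⊆A →
    decidable-stable (M (ρ ++ τ) ≟ M ρ) λ change → none (τ , τ⊆A , change)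

  StabilisesOn : (ℕ → ℕ) → Pred ℕ 0ℓ
  StabilisesOn μ i = ∃ λ N → ∀ s → N ≤ s → M (μ [ s ]) ≡ i

  -- The enumeration is fixed before the conjecture `i` is known, and only equality of conjectures
  -- matters here: `E` enters later, when `i` is known to be correct.
  diagonalEnumeration : Satisfiable A →
    ∃ λ μ → Enumerates μ A ×
      (∀ {i} → StabilisesOn μ i → ∃ λ ρ → range ρ ⊆ A × M ρ ≡ i × Locked ρ)
  diagonalEnumeration sat = limit , record { into = into ; onto = onto } , locks
    where
    ν : ℕ → ℕ
    ν = proj₁ (enumeration em sat)
    open Enumerates (proj₂ (enumeration em sat)) renaming (into to ν-into; onto to ν-onto)

    response : List ℕ → List ℕ
    response ρ = proj₁ (mindChange ρ)

    σ ρ : ℕ → List ℕ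
    σ zero    = []
    σ (suc n) = ρ n ++ response (ρ n)
    ρ n = σ n ∷ʳ ν n

    σ⊆A : ∀ n → range (σ n) ⊆ A
    ρ⊆A : ∀ n → range (ρ n) ⊆ A
    σ⊆A (suc n) = [ ρ⊆A n , proj₁ (proj₂ (mindChange (ρ n))) ]′ ∘ ∈-++⁻ (ρ n)
    ρ⊆A n = [ σ⊆A n , (λ { (here refl) → ν-into n }) ]′ ∘ ∈-++⁻ (σ n)

    ρ≼σ : ∀ n → ρ n ≼ σ (suc n)
    ρ≼σ n = response (ρ n) , refl

    σ-long : ∀ n → n ≤ length (σ n)
    ρ-long : ∀ n → suc n ≤ length (ρ n)
    σ-long zero    = z≤n
    σ-long (suc n) = let open ≤-Reasoning in begin
      suc n             ≤⟨ ρ-long n ⟩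
      length (ρ n)      ≤⟨ length-++-≤ˡ (ρ n) ⟩
      length (σ (suc n)) ∎
    ρ-long n = let open ≤-Reasoning in begin
      suc n              ≡⟨ +-comm 1 n ⟩
      n + 1              ≤⟨ +-monoˡ-≤ 1 (σ-long n) ⟩
      length (σ n) + 1   ≡⟨ length-++ (σ n) ⟨
      length (ρ n)       ∎

    -- The default `ν 0` lies in `A`, as `at-∈` demands in `into`.
    open Limit (ν 0) σ (λ n → ≼-trans (ν n ∷ [] , refl) (ρ≼σ n)) σ-long

    into : ∀ n → limit n ∈ A
    into n = at-∈ (ν-into 0) (σ (suc n)) (σ⊆A (suc n)) n

    onto : ∀ {x} → x ∈ A → ∃ λ n → limit n ≡ x
    onto x∈A with n , refl ← ν-onto x∈A =
      -- `ν n` is the last entry of `ρ n`, which is an initial segment of `limit`.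
      let i , _ , νn≡ = ∈-applyUpTo⁻ limit
            (subst (ν n Mem.∈_) (sym (limit-initial (suc n) (ρ≼σ n)))
                   (∈-++⁺ʳ (σ n) (here refl)))
      in i , sym νn≡

    locks : ∀ {i} → StabilisesOn limit i → ∃ λ ρ → range ρ ⊆ A × M ρ ≡ i × Locked ρ
    locks {i} (N , stable) = ρ N , ρ⊆A N , Mρ≡i ,
      -- By definition `σ (suc N)` is `ρ N ++ response (ρ N)`, so the two equations say that the
      -- response causes no mind change.
      proj₂ (proj₂ (mindChange (ρ N))) (trans Mσ≡i (sym Mρ≡i))
      where
      stable-≼ : ∀ {xs} → xs ≼ σ (suc N) → N ≤ length xs → M xs ≡ i
      stable-≼ xs≼σ N≤l = trans (cong M (sym (limit-initial (suc N) xs≼σ))) (stable _ N≤l)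

      Mρ≡i : M (ρ N) ≡ i
      Mρ≡i = stable-≼ (ρ≼σ N) (≤-trans (n≤1+n N) (ρ-long N))

      Mσ≡i : M (σ (suc N)) ≡ i
      Mσ≡i = stable-≼ ≼-refl (≤-trans (n≤1+n N) (σ-long (suc N)))

theorem3p2 : ∀ {ℓ k} → ExcludedMiddle ℓ →
    (Φ : AcceptableEnumeration) →
    (E : Rel ℕ ℓ) → IsEquivalence E → _=ᶜᵉ_ Φ ⇒ E →
    (𝔎 : Pred (Pred ℕ 0ℓ) k) → IsNonemptyCEFamily Φ 𝔎 →
    (M : Learner) → Learns Φ E M 𝔎 →
    ∀ e → W Φ e ∈ 𝔎 → ∃ λ σ → IsLockingSequence Φ E M e σ
theorem3p2 em Φ E _ _ 𝔎 𝔎-family M learns e We∈𝔎 =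
  let μ , μ-enumerates , locks =
        -- Nonemptiness of `W e` provides the filler value for `enumeration`.
        diagonalEnumeration (lowerEM em) M (IsNonemptyCEFamily.nonempty 𝔎-family We∈𝔎)
      i , iEe , stabilises = learns e We∈𝔎 μ μ-enumerates
      ρ , ρ⊆We , Mρ≡i , locked = locks stabilises
  in ρ , record
    { range⊆  = ρ⊆We
    ; correct = subst (λ j → E j e) (sym Mρ≡i) iEe
    ; locked  = locked
    }
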